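{- Let $\mathcal{C}\subseteq 2^{[n]}$ and $\mathcal{D}\subseteq 2^{[m]}$ be codes with $\emptyset\in\mathcal{C}$ and $\emptyset\in\mathcal{D}$. Let $\mathcal{C}\amalg\mathcal{D}=\{c\cup\{n+m+1\}\mid c\in\mathcal{C}\}\cup\{(d+n)\cup\{n+m+2\}\mid d\in\mathcal{D}\}\subseteq 2^{[n+m+2]}$, where $d+n=\{j+n\mid j\in d\}$. Then $\mathcal{C}$ and $\mathcal{D}$ are both convex if and only if $\mathcal{C}\amalg\mathcal{D}\cup\{\emptyset\}$ is convex, and in that case $\mathrm{mindim}(\mathcal{C}\amalg\mathcal{D}\cup\{\emptyset\})=\max\{\mathrm{mindim}(\mathcal{C}),\mathrm{mindim}(\mathcal{D})\}$.
   Context: A code is a subset $\mathcal{C}\subseteq 2^{[n]}$. Given $U_1,\dots,U_n\subseteq X$, $\mathrm{code}(\mathcal{U},X)=\{\sigma\subseteq[n]\mid \bigcap_{i\in\sigma}U_i\setminus\bigcup_{j\notin\sigma}U_j\neq\emptyset\}$ with the empty intersection equal to $X$. A code is convex if it equals $\mathrm{code}(\mathcal{U},X)$ for some open convex $X\subseteq\mathbb{R}^d$ and convex open $U_i\subseteq X$; $\mathrm{mindim}$ is the least such $d$.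
   Formalization: The dimension d is taken to be at least 1; if d = 0 were allowed, the mindim formula would fail for C = D = {∅}, where both mindims would be 0 while the coproduct with ∅ added has three codewords and mindim 1. -}

module Defs where

open import Algebra.Bundles using (CommutativeRing)
import Algebra.Definitions.RawMonoid as RawMonoid
open import Axiom.ExcludedMiddle using (ExcludedMiddle)
open import Data.Fin.Base using (Fin)
open import Data.Fin.Subset using (Subset; inside; outside; ⊥)
  renaming (_∈_ to _∈ₛ_; _∉_ to _∉ₛ_)
open import Data.Nat.Base as ℕ using (ℕ)
open import Data.Nat.Induction using (<-wellFounded)
import Data.Nat.Properties as ℕ
open import Data.Product using (∃; ∃-syntax; _×_; _,_; proj₁; proj₂)
open import Data.Sum.Base using (_⊎_)
open import Data.Vec.Base using (_++_; _∷_; [])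
open import Data.Vec.Functional using (Vector)
open import Function.Base using (_∘_)
open import Induction.WellFounded using (Acc; acc)
open import Level using (0ℓ) renaming (suc to lsuc)
open import Relation.Binary.Core using (Rel)
open import Relation.Binary.Structures using (IsStrictTotalOrder)
open import Relation.Binary.PropositionalEquality using (_≡_)
open import Relation.Nullary using (¬_; yes; no)
open import Relation.Unary using (Pred; _∈_; _⊆_; _≐_; _∩_; _∖_; Satisfiable; ⋂; ⋃)

-- The real numbers, presented as a Dedekind-complete totally ordered field.
-- Classically this determines them up to isomorphism.

record RealNumbers : Set₁ where
  field
    commutativeRing : CommutativeRing 0ℓ 0ℓ

  open CommutativeRing commutativeRing public

  infix 4 _<_ _≤_

  field
    0#≉1#              : ¬ (0# ≈ 1#)
    inverse            : ∀ x → ¬ (x ≈ 0#) → ∃[ y ] x * y ≈ 1#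
    _<_                : Rel Carrier 0ℓ
    isStrictTotalOrder : IsStrictTotalOrder _≈_ _<_
    +-monoʳ-<          : ∀ x {y z} → y < z → x + y < x + z
    *-pos              : ∀ {x y} → 0# < x → 0# < y → 0# < x * y

  _≤_ : Rel Carrier 0ℓ
  x ≤ y = x < y ⊎ x ≈ y

  UpperBound : Pred Carrier 0ℓ → Pred Carrier 0ℓ
  UpperBound P b = ∀ x → x ∈ P → x ≤ b

  field
    supremum : ∀ P → Satisfiable P → Satisfiable (UpperBound P) →
               ∃[ s ] s ∈ UpperBound P × (∀ b → b ∈ UpperBound P → s ≤ b)

module Euclidean (ℝ : RealNumbers) where
  open RealNumbers ℝ
  open RawMonoid +-rawMonoid using (sum)

  Space : ℕ → Set
  Space d = Vector Carrier d

  dist² : ∀ {d} → Space d → Space d → Carrier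
  dist² x y = sum λ i → (x i - y i) * (x i - y i)

  -- Euclidean distance less than ε, squared to avoid square roots.
  Ball : ∀ {d} → Space d → Carrier → Pred (Space d) 0ℓ
  Ball x ε y = dist² x y < ε * ε

  IsOpen : ∀ {d} → Pred (Space d) 0ℓ → Set
  IsOpen A = ∀ {x} → x ∈ A → ∃[ ε ] 0# < ε × Ball x ε ⊆ A

  IsConvexSet : ∀ {d} → Pred (Space d) 0ℓ → Set
  IsConvexSet A = ∀ {x y} → x ∈ A → y ∈ A → ∀ t → 0# ≤ t → t ≤ 1# →
                  (λ i → (1# - t) * x i + t * y i) ∈ A

Code : ℕ → Set₁
Code n = Pred (Subset n) 0ℓ

-- Intersecting with X makes the intersection over the empty σ equal to X; it
-- changes nothing for nonempty σ when every U i is contained in X.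
code : {A : Set} {n : ℕ} → (Fin n → Pred A 0ℓ) → Pred A 0ℓ → Code n
code U X σ = Satisfiable
  ((X ∩ ⋂ (∃ (_∈ₛ σ)) (U ∘ proj₁)) ∖ ⋃ (∃ (_∉ₛ σ)) (U ∘ proj₁))

infixr 6 _∐_

data _∐_ {n m : ℕ} (C : Code n) (D : Code m) : Code (n ℕ.+ m ℕ.+ 2) where
  left  : ∀ {c} → c ∈ C → (C ∐ D) ((c ++ ⊥ {m}) ++ inside ∷ outside ∷ [])
  right : ∀ {d} → d ∈ D → (C ∐ D) ((⊥ {n} ++ d) ++ outside ∷ inside ∷ [])

module _ (ℝ : RealNumbers) where
  open Euclidean ℝ

  record Realization {n : ℕ} (C : Code n) (d : ℕ) : Set₁ where
    field
      X        : Pred (Space d) 0ℓ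
      U        : Fin n → Pred (Space d) 0ℓ
      X-open   : IsOpen X
      X-convex : IsConvexSet X
      U⊆X      : ∀ i → U i ⊆ X
      U-open   : ∀ i → IsOpen (U i)
      U-convex : ∀ i → IsConvexSet (U i)
      realizes : C ≐ code U X

  -- Dimensions start at 1.  If ℝ⁰ were allowed, then {∅} would have minimal
  -- dimension 0, but ({∅} ∐ {∅}) ∪ {∅} has three codewords and so is not
  -- realized in ℝ⁰, and the minimal dimension of the coproduct would not be
  -- the maximum of the two.
  IsConvexIn : ∀ {n} → Code n → ℕ → Set₁
  IsConvexIn C d = 1 ℕ.≤ d × Realization C d

  IsConvex : ∀ {n} → Code n → Set₁
  IsConvex C = ∃ (IsConvexIn C)

IsLeast : ∀ {ℓ} → Pred ℕ ℓ → Pred ℕ ℓ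
IsLeast P d = P d × (∀ k → P k → d ℕ.≤ k)

least : ∀ {ℓ} → ExcludedMiddle ℓ → (P : Pred ℕ ℓ) → ∃ P → ∃ (IsLeast P)
least {ℓ} em P (n , p) = go n p (<-wellFounded n)
  where
  go : ∀ n → P n → Acc ℕ._<_ n → ∃ (IsLeast P)
  go n p (acc rs) with em {∃[ k ] k ℕ.< n × P k}
  ... | yes (k , k<n , q) = go k q (rs k<n)
  ... | no ∄k             = n , p , λ k q → ℕ.≮⇒≥ λ k<n → ∄k (k , k<n , q)

mindim : ExcludedMiddle (lsuc 0ℓ) → (ℝ : RealNumbers) →
         ∀ {n} (C : Code n) → IsConvex ℝ C → ℕ
mindim em ℝ C p = proj₁ (least em (IsConvexIn ℝ C) p)

{-# OPTIONS --safe #-}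

-- A realization of (C ∐ D) ∪ {∅} restricts to realizations of C and of D inside
-- the two sets indexed by the last two elements, in the same dimension.
-- Conversely, raise realizations of C and D to a common dimension by cylinders.
-- Codes are finite, so after a translation each code is still realized inside an
-- open half-space; placing them in {x₀ > 0} and {x₀ < 0} makes the sets disjoint
-- and leaves the origin to realize ∅. So dimension k suits the coproduct iff it
-- suits both C and D, and the suitable dimensions are upward closed.

module Submission where

open import Defs
open import Axiom.ExcludedMiddle using (ExcludedMiddle)
open import Data.Fin.Subset using (⊥)
open import Data.Nat.Base using (ℕ; _⊔_)
open import Data.Product using (_×_)
open import Function.Bundles using (_⇔_)
open import Level using (0ℓ; suc)
open import Relation.Binary.PropositionalEquality using (_≡_)
open import Relation.Unary using (_∈_; _∪_; ｛_｝)

import Algebra.Properties.CommutativeSemigroup as CommutativeSemigroupProperties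
import Algebra.Properties.Monoid.Sum as SumProperties
import Algebra.Properties.Ring as RingProperties
open import Data.Bool.Base using (true; false)
open import Data.Empty using (⊥-elim)
open import Data.Fin.Base using (Fin; zero; splitAt; _↑ˡ_; _↑ʳ_) renaming (suc to fsuc)
open import Data.Fin.Properties using (splitAt-↑ˡ; splitAt-↑ʳ)
open import Data.Fin.Subset using (Subset; inside; outside) renaming (_∈_ to _∈ₛ_)
open import Data.Fin.Subset.Properties using (⊆-antisym; ∉⊥; _∈?_; drop-there)
import Data.Nat.Base as ℕ
import Data.Nat.Properties as ℕ
open import Data.Product using (∃; ∃-syntax; _,_; proj₁; proj₂)
open import Data.Sum.Base using (_⊎_; inj₁; inj₂; [_,_]′; map₁)
open import Data.Vec.Base using ([]; _∷_; _++_; here; there)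
open import Data.Vec.Properties using (lookup-++ˡ; lookup-++ʳ; []=⇒lookup; lookup⇒[]=)
open import Function.Base using (_∘_)
open import Function.Bundles using (mk⇔; Equivalence)
import Function.Properties.Equivalence as ⇔
open import Level using (lift; lower; Lift)
open import Relation.Binary.Definitions using (tri<; tri≈; tri>)
import Relation.Binary.Construct.StrictToNonStrict as ToNonStrict
import Relation.Binary.PropositionalEquality as ≡
open import Relation.Binary.Structures using (IsStrictTotalOrder)
open import Relation.Nullary using (¬_; yes; no; contradiction)
open import Relation.Nullary.Decidable using (map′; decidable-stable)
open import Relation.Unary using (Pred; _⊆_; _⊢_; _∩_) renaming (U to Universal)

open Equivalence using (to; from)

-- Codewords of points.

lowerExcludedMiddle : ExcludedMiddle (suc 0ℓ) → ExcludedMiddle 0ℓ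
lowerExcludedMiddle em {P} = map′ lower lift (em {Lift (suc 0ℓ) P})

-- One equivalence per index replaces the intersection minus union of `code`, so that changing the
-- sets or the indices amounts to composing equivalences.
Matches : ∀ {n} → Subset n → (Fin n → Set) → Set
Matches σ V = ∀ i → i ∈ₛ σ ⇔ V i

Matches-unique : ∀ {n} {σ τ : Subset n} {V} → Matches σ V → Matches τ V → σ ≡ τ
Matches-unique p q = ⊆-antisym
  (λ {i} i∈σ → from (q i) (to (p i) i∈σ))
  (λ {i} i∈τ → from (p i) (to (q i) i∈τ))

⊥-Matches : ∀ {n} {V : Fin n → Set} → (∀ i → ¬ V i) → Matches ⊥ V
⊥-Matches ¬V i = mk⇔ (⊥-elim ∘ ∉⊥) (⊥-elim ∘ ¬V i)

∷-Matches : ∀ {n s} {σ : Subset n} {V} → (s ≡ inside ⇔ V zero) →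
            Matches σ (V ∘ fsuc) → Matches (s ∷ σ) V
∷-Matches h t zero    = ⇔.trans (mk⇔ (λ { here → ≡.refl }) (λ { ≡.refl → here })) h
∷-Matches h t (fsuc i) = ⇔.trans (mk⇔ drop-there there) (t i)

++-Matches : ∀ {n m} {σ : Subset n} {τ : Subset m} {V} →
             Matches σ (V ∘ (_↑ˡ m)) → Matches τ (V ∘ (n ↑ʳ_)) → Matches (σ ++ τ) V
++-Matches {σ = []}    p q = q
++-Matches {σ = s ∷ σ} p q = ∷-Matches
  (⇔.trans (mk⇔ (λ { ≡.refl → here }) (λ { here → ≡.refl })) (p zero))
  (++-Matches (λ i → ⇔.trans (mk⇔ there drop-there) (p (fsuc i))) q)

∈-++ˡ : ∀ {n m} (σ : Subset n) (τ : Subset m) i → i ∈ₛ σ ⇔ (i ↑ˡ m) ∈ₛ σ ++ τ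
∈-++ˡ σ τ i = mk⇔
  (λ h → lookup⇒[]= _ _ (≡.trans (lookup-++ˡ σ τ i) ([]=⇒lookup h)))
  (λ h → lookup⇒[]= _ _ (≡.trans (≡.sym (lookup-++ˡ σ τ i)) ([]=⇒lookup h)))

∈-++ʳ : ∀ {n m} (σ : Subset n) (τ : Subset m) i → i ∈ₛ τ ⇔ (n ↑ʳ i) ∈ₛ σ ++ τ
∈-++ʳ σ τ i = mk⇔
  (λ h → lookup⇒[]= _ _ (≡.trans (lookup-++ʳ σ τ i) ([]=⇒lookup h)))
  (λ h → lookup⇒[]= _ _ (≡.trans (≡.sym (lookup-++ʳ σ τ i)) ([]=⇒lookup h)))

-- Membership of a point in a set of reals is not decidable, so excluded middle settles the indices
-- one by one; this gives every point a codeword.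
Matches-total : ExcludedMiddle 0ℓ → ∀ {n} (V : Fin n → Set) → ∃[ σ ] Matches σ V
Matches-total em {ℕ.zero}  V = [] , λ ()
Matches-total em {ℕ.suc n} V with em {V zero} | Matches-total em (V ∘ fsuc)
... | yes v | σ , p = inside ∷ σ , ∷-Matches (mk⇔ (λ _ → v) (λ _ → ≡.refl)) p
... | no ¬v | σ , p = outside ∷ σ , ∷-Matches (mk⇔ (λ ()) (⊥-elim ∘ ¬v)) p

module _ {A : Set} {n : ℕ} {V : Fin n → Pred A 0ℓ} {X : Pred A 0ℓ} {σ : Subset n} where

  code⇒Matches : σ ∈ code V X → ∃[ p ] p ∈ X × Matches σ (λ i → V i p)
  code⇒Matches (p , (p∈X , p∈V) , p∉V) = p , p∈X , λ i → mk⇔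
    (λ i∈σ → p∈V (i , i∈σ))
    -- Lying in no set indexed outside `σ` only refutes `i ∉ σ`; decidability of membership in `σ`
    -- removes the double negation.
    (λ p∈Vi → decidable-stable (i ∈? σ) (λ i∉σ → p∉V ((i , i∉σ) , p∈Vi)))

  Matches⇒code : ∀ {p} → p ∈ X → Matches σ (λ i → V i p) → σ ∈ code V X
  Matches⇒code {p} p∈X m =
    p , (p∈X , λ { (i , i∈σ) → to (m i) i∈σ }) , λ { ((i , i∉σ) , v) → i∉σ (from (m i) v) }

-- Positions and words of the coproduct.

module Coproduct {n m : ℕ} where

  leftIndex : Fin n → Fin (n ℕ.+ m ℕ.+ 2)
  leftIndex i = (i ↑ˡ m) ↑ˡ 2

  rightIndex : Fin m → Fin (n ℕ.+ m ℕ.+ 2)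
  rightIndex j = (n ↑ʳ j) ↑ˡ 2

  leftTag rightTag : Fin (n ℕ.+ m ℕ.+ 2)
  leftTag  = (n ℕ.+ m) ↑ʳ zero
  rightTag = (n ℕ.+ m) ↑ʳ fsuc zero

  leftWord : Subset n → Subset (n ℕ.+ m ℕ.+ 2)
  leftWord c = (c ++ ⊥ {m}) ++ inside ∷ outside ∷ []

  rightWord : Subset m → Subset (n ℕ.+ m ℕ.+ 2)
  rightWord d = (⊥ {n} ++ d) ++ outside ∷ inside ∷ []

  ∈-leftWord : ∀ c i → i ∈ₛ c ⇔ leftIndex i ∈ₛ leftWord c
  ∈-leftWord c i = ⇔.trans (∈-++ˡ c ⊥ i) (∈-++ˡ (c ++ ⊥) _ (i ↑ˡ m))

  ∈-rightWord : ∀ d j → j ∈ₛ d ⇔ rightIndex j ∈ₛ rightWord d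
  ∈-rightWord d j = ⇔.trans (∈-++ʳ (⊥ {n}) d j) (∈-++ˡ (⊥ {n} ++ d) _ (n ↑ʳ j))

  leftTag∈leftWord : ∀ c → leftTag ∈ₛ leftWord c
  leftTag∈leftWord c = to (∈-++ʳ (c ++ ⊥ {m}) _ zero) here

  rightTag∈rightWord : ∀ d → rightTag ∈ₛ rightWord d
  rightTag∈rightWord d = to (∈-++ʳ (⊥ {n} ++ d) _ (fsuc zero)) (there here)

  leftTag∉rightWord : ∀ d → ¬ leftTag ∈ₛ rightWord d
  leftTag∉rightWord d h with from (∈-++ʳ (⊥ {n} ++ d) _ zero) h
  ... | ()

  rightTag∉leftWord : ∀ c → ¬ rightTag ∈ₛ leftWord c
  rightTag∉leftWord c h with from (∈-++ʳ (c ++ ⊥ {m}) _ (fsuc zero)) h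
  ... | there ()

-- Arithmetic of ordered fields.

module OrderedField (ℝ : RealNumbers) where
  open RealNumbers ℝ hiding (zero)
  open RingProperties ring public
    using (-‿distribˡ-*; -‿distribʳ-*; -‿involutive; -‿anti-homo-+; -‿+-comm; xyx⁻¹≈y)
    renaming (//-rightDividesˡ to x-y+y≈x; \\-leftDividesˡ to x+[-x+y]≈y)
  open CommutativeSemigroupProperties +-commutativeSemigroup public
    using () renaming (interchange to +-interchange)
  open IsStrictTotalOrder isStrictTotalOrder public
    using (compare; irrefl; asym; <-respˡ-≈; <-respʳ-≈; <-resp-≈) renaming (trans to <-trans)

  ≤-total : ∀ x y → x ≤ y ⊎ y ≤ x
  ≤-total = ToNonStrict.total _≈_ _<_ compare

  <-≤-trans : ∀ {x y z} → x < y → y ≤ z → x < z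
  <-≤-trans = ToNonStrict.<-≤-trans _≈_ _<_ <-trans <-respʳ-≈

  ≤-<-trans : ∀ {x y z} → x ≤ y → y < z → x < z
  ≤-<-trans = ToNonStrict.≤-<-trans _≈_ _<_ sym <-trans <-respˡ-≈

  ≤-trans : ∀ {x y z} → x ≤ y → y ≤ z → x ≤ z
  ≤-trans = ToNonStrict.trans _≈_ _<_ isEquivalence <-resp-≈ <-trans

  ≤⇒≯ : ∀ {x y} → x ≤ y → ¬ y < x
  ≤⇒≯ x≤y y<x = irrefl refl (≤-<-trans x≤y y<x)

  +-monoʳ-≤ : ∀ x {y z} → y ≤ z → x + y ≤ x + z
  +-monoʳ-≤ x (inj₁ y<z) = inj₁ (+-monoʳ-< x y<z)
  +-monoʳ-≤ x (inj₂ y≈z) = inj₂ (+-congˡ y≈z)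

  x≤x+y : ∀ x {y} → 0# ≤ y → x ≤ x + y
  x≤x+y x 0≤y = ≤-trans (inj₂ (sym (+-identityʳ x))) (+-monoʳ-≤ x 0≤y)

  x≤y+x : ∀ x {y} → 0# ≤ y → x ≤ y + x
  x≤y+x x 0≤y = ≤-trans (x≤x+y x 0≤y) (inj₂ (+-comm x _))

  x<y⇒0<y-x : ∀ {x y} → x < y → 0# < y - x
  x<y⇒0<y-x {x} {y} x<y =
    <-respʳ-≈ (+-comm (- x) y) (<-respˡ-≈ (-‿inverseˡ x) (+-monoʳ-< (- x) x<y))

  x≤y⇒0≤y-x : ∀ {x y} → x ≤ y → 0# ≤ y - x
  x≤y⇒0≤y-x (inj₁ x<y)     = inj₁ (x<y⇒0<y-x x<y)
  x≤y⇒0≤y-x {x} (inj₂ x≈y) = inj₂ (trans (sym (-‿inverseʳ x)) (+-congʳ x≈y))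

  0<-x : ∀ {x} → x < 0# → 0# < - x
  0<-x {x} x<0 = <-respʳ-≈ (+-identityˡ (- x)) (x<y⇒0<y-x x<0)

  -x*-x≈x*x : ∀ x → - x * - x ≈ x * x
  -x*-x≈x*x x = trans (sym (-‿distribˡ-* x (- x)))
    (trans (-‿cong (sym (-‿distribʳ-* x x))) (-‿involutive (x * x)))

  0≤x*x : ∀ x → 0# ≤ x * x
  0≤x*x x with compare 0# x
  ... | tri< 0<x _ _ = inj₁ (*-pos 0<x 0<x)
  ... | tri≈ _ 0≈x _ = inj₂ (trans (sym (zeroˡ x)) (*-congʳ 0≈x))
  ... | tri> _ _ x<0 = inj₁ (<-respʳ-≈ (-x*-x≈x*x x) (*-pos (0<-x x<0) (0<-x x<0)))

  0<1 : 0# < 1#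
  0<1 with 0≤x*x 1#
  ... | inj₁ 0<1*1 = <-respʳ-≈ (*-identityˡ 1#) 0<1*1
  ... | inj₂ 0≈1*1 = contradiction (trans 0≈1*1 (*-identityˡ 1#)) 0#≉1#

  0≤x*y : ∀ {x y} → 0# ≤ x → 0# ≤ y → 0# ≤ x * y
  0≤x*y (inj₁ 0<x) (inj₁ 0<y) = inj₁ (*-pos 0<x 0<y)
  0≤x*y (inj₂ 0≈x) _          = inj₂ (trans (sym (zeroˡ _)) (*-congʳ 0≈x))
  0≤x*y _          (inj₂ 0≈y) = inj₂ (trans (sym (zeroʳ _)) (*-congˡ 0≈y))

  *-monoʳ-≤ : ∀ {x y z} → 0# ≤ x → y ≤ z → x * y ≤ x * z
  *-monoʳ-≤ {x} {y} {z} 0≤x y≤z =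
    -- `x * z` equals `x * (z - y) + x * y`, whose first summand is nonnegative.
    ≤-trans (x≤y+x (x * y) (0≤x*y 0≤x (x≤y⇒0≤y-x y≤z)))
      (inj₂ (trans (sym (distribˡ x (z - y) y)) (*-congˡ (x-y+y≈x y z))))

  square-mono : ∀ {x y} → 0# ≤ x → x ≤ y → x * x ≤ y * y
  square-mono {x} {y} 0≤x x≤y =
    ≤-trans (*-monoʳ-≤ 0≤x x≤y)
      (≤-trans (inj₂ (*-comm x y)) (*-monoʳ-≤ (≤-trans 0≤x x≤y) x≤y))

  1-t+t≈1 : ∀ t → (1# - t) + t ≈ 1#
  1-t+t≈1 t = x-y+y≈x t 1#

  -- One of the weights `t` and `1# - t` is positive, and its summand makes the inequality strict;
  -- the case split on `0# ≤ t` decides which one is used.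
  0<convex : ∀ {x y t} → 0# < x → 0# < y → 0# ≤ t → t ≤ 1# →
             0# < (1# - t) * x + t * y
  0<convex {x} {y} {t} 0<x 0<y (inj₁ 0<t) t≤1 =
    <-≤-trans (*-pos 0<t 0<y) (x≤y+x (t * y) (0≤x*y (x≤y⇒0≤y-x t≤1) (inj₁ 0<x)))
  0<convex {x} {y} {t} 0<x 0<y (inj₂ 0≈t) t≤1 =
    <-≤-trans (*-pos 0<1-t 0<x) (x≤x+y _ (0≤x*y (inj₂ 0≈t) (inj₁ 0<y)))
    where
    0<1-t : 0# < 1# - t
    0<1-t = x<y⇒0<y-x (<-respˡ-≈ 0≈t 0<1)

-- Open convex sets and affine contractions.

module Geometry (ℝ : RealNumbers) where
  open RealNumbers ℝ hiding (zero)
  open Euclidean ℝ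
  open OrderedField ℝ
  open SumProperties +-monoid using (sum-cong-≋)

  segment : ∀ {d} → Carrier → Space d → Space d → Space d
  segment t x y i = (1# - t) * x i + t * y i

  Positive : ∀ {d} → Pred (Space (ℕ.suc d)) 0ℓ
  Positive x = 0# < x zero

  0≤dist² : ∀ {d} (x y : Space d) → 0# ≤ dist² x y
  0≤dist² {ℕ.zero}  x y = inj₂ refl
  0≤dist² {ℕ.suc d} x y =
    ≤-trans (0≤x*x _) (x≤x+y _ (0≤dist² (x ∘ fsuc) (y ∘ fsuc)))

  dist²-≋ : ∀ {d} {x y : Space d} → (∀ i → x i ≈ y i) → dist² x y ≈ 0#
  dist²-≋ {ℕ.zero}  x≋y = refl
  dist²-≋ {ℕ.suc d} {x} {y} x≋y =
    trans (+-cong (trans (*-congʳ x₀-y₀≈0) (zeroˡ _)) (dist²-≋ (x≋y ∘ fsuc))) (+-identityˡ 0#)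
    where
    x₀-y₀≈0 : x zero - y zero ≈ 0#
    x₀-y₀≈0 = trans (+-congʳ (x≋y zero)) (-‿inverseʳ (y zero))

  -- Sets are predicates on representatives, and only openness makes them
  -- invariant under the equality of coordinates.
  IsOpen⇒resp : ∀ {d} {A : Pred (Space d) 0ℓ} → IsOpen A →
                ∀ {x y} → (∀ i → x i ≈ y i) → x ∈ A → y ∈ A
  IsOpen⇒resp A-open x≋y x∈A with A-open x∈A
  ... | ε , 0<ε , ball⊆A = ball⊆A (<-respˡ-≈ (sym (dist²-≋ x≋y)) (*-pos 0<ε 0<ε))

  Ball-mono : ∀ {d} (x : Space d) {δ ε} → 0# < δ → δ ≤ ε → Ball x δ ⊆ Ball x ε
  Ball-mono x 0<δ δ≤ε y∈B = <-≤-trans y∈B (square-mono (inj₁ 0<δ) δ≤ε)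

  ∩-open : ∀ {d} {A B : Pred (Space d) 0ℓ} → IsOpen A → IsOpen B → IsOpen (A ∩ B)
  ∩-open A-open B-open {x} (x∈A , x∈B) with A-open x∈A | B-open x∈B
  ... | δ , 0<δ , δ⊆A | ε , 0<ε , ε⊆B with ≤-total δ ε
  ...   | inj₁ δ≤ε = δ , 0<δ , λ {y} b → δ⊆A b , ε⊆B (Ball-mono x 0<δ δ≤ε {y} b)
  ...   | inj₂ ε≤δ = ε , 0<ε , λ {y} b → δ⊆A (Ball-mono x 0<ε ε≤δ {y} b) , ε⊆B b

  ∩-convex : ∀ {d} (A B : Pred (Space d) 0ℓ) →
             IsConvexSet A → IsConvexSet B → IsConvexSet (A ∩ B)
  ∩-convex A B A-convex B-convex (x∈A , x∈B) (y∈A , y∈B) t 0≤t t≤1 =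
    A-convex x∈A y∈A t 0≤t t≤1 , B-convex x∈B y∈B t 0≤t t≤1

  Universal-open : ∀ {d} → IsOpen (Universal {A = Space d})
  Universal-open _ = 1# , 0<1 , _

  Positive-open : ∀ {d} → IsOpen (Positive {d})
  -- The radius is the distance from `x` to the bounding hyperplane: a point with nonpositive first
  -- coordinate differs from `x` there by at least `x zero`.
  Positive-open {d} {x} 0<x₀ = x zero , 0<x₀ , λ {y} → ball⊆Positive {y}
    where
    farFromNonpositive : ∀ y → y zero ≤ 0# → x zero * x zero ≤ dist² x y
    farFromNonpositive y y₀≤0 = ≤-trans
      (square-mono (inj₁ 0<x₀) (x≤x+y _ (≤-trans (x≤y⇒0≤y-x y₀≤0) (inj₂ (+-identityˡ _)))))
      (x≤x+y _ (0≤dist² (x ∘ fsuc) (y ∘ fsuc)))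

    ball⊆Positive : Ball x (x zero) ⊆ Positive
    ball⊆Positive {y} y∈B with compare 0# (y zero)
    ... | tri< 0<y₀ _ _ = 0<y₀
    ... | tri≈ _ 0≈y₀ _ = contradiction y∈B (≤⇒≯ (farFromNonpositive y (inj₂ (sym 0≈y₀))))
    ... | tri> _ _ y₀<0 = contradiction y∈B (≤⇒≯ (farFromNonpositive y (inj₁ y₀<0)))

  Positive-convex : ∀ {d} → IsConvexSet (Positive {d})
  Positive-convex 0<x₀ 0<y₀ t = 0<convex 0<x₀ 0<y₀

  -- What is needed to pull a realization back: contraction keeps preimages open with the same
  -- radius, affinity keeps them convex, and the section makes the map surjective, so that no
  -- codeword is lost.
  record AffineContraction (k l : ℕ) : Set where
    field
      map         : Space k → Space l
      contracting : ∀ x y → dist² (map x) (map y) ≤ dist² x y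
      affine      : ∀ t x y i → map (segment t x y) i ≈ segment t (map x) (map y) i
      section     : Space l → Space k
      map-section : ∀ x i → map (section x) i ≈ x i

    preimage-open : ∀ A → IsOpen A → IsOpen (map ⊢ A)
    preimage-open A A-open {x} fx∈A with A-open fx∈A
    ... | ε , 0<ε , ball⊆A = ε , 0<ε , λ {y} y∈B → ball⊆A (≤-<-trans (contracting x y) y∈B)

    -- Openness enters because `affine` holds only up to equality of coordinates, which an arbitrary
    -- predicate need not respect.
    preimage-convex : ∀ A → IsOpen A → IsConvexSet A → IsConvexSet (map ⊢ A)
    preimage-convex A A-open A-convex {x} {y} fx∈A fy∈A t 0≤t t≤1 =
      IsOpen⇒resp A-open (λ i → sym (affine t x y i)) (A-convex fx∈A fy∈A t 0≤t t≤1)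

  -- Preimages under this projection are cylinders. The `0#` in the section is an arbitrary choice
  -- of first coordinate.
  dropFirst : ∀ d → AffineContraction (ℕ.suc d) d
  dropFirst d = record
    { map         = _∘ fsuc
    ; contracting = λ x y → x≤y+x _ (0≤x*x _)
    ; affine      = λ _ _ _ _ → refl
    ; section     = λ { x zero → 0# ; x (fsuc i) → x i }
    ; map-section = λ _ _ → refl
    }

  -- An involutive isometry that exchanges `Positive` with the opposite half-space.
  reflection : ∀ d → AffineContraction d d
  reflection d = record
    { map         = λ x i → - x i
    ; contracting = λ x y → inj₂ (sum-cong-≋ λ i →
        trans (*-cong (-‿+-comm (x i) (- y i)) (-‿+-comm (x i) (- y i))) (-x*-x≈x*x _))
    ; affine      = λ t x y i → trans (sym (-‿+-comm _ _))
        (+-cong (-‿distribʳ-* (1# - t) (x i)) (-‿distribʳ-* t (y i)))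
    ; section     = λ x i → - x i
    ; map-section = λ x i → -‿involutive (x i)
    }

  -- The shift is along the diagonal, so all coordinates are treated alike; only its effect on
  -- coordinate zero bears on the half-space.
  translation : ∀ d → Carrier → AffineContraction d d
  translation d a = record
    { map         = λ x i → x i + a
    ; contracting = λ x y → inj₂ (sum-cong-≋ λ i →
        *-cong (difference (x i) (y i)) (difference (x i) (y i)))
    ; affine      = λ t x y i → sym (trans
        (+-cong (distribˡ (1# - t) (x i) a) (distribˡ t (y i) a))
        (trans (+-interchange _ _ _ _) (+-congˡ (convex-self t))))
    ; section     = λ x i → x i - a
    ; map-section = λ x i → x-y+y≈x a (x i)
    }
    where
    difference : ∀ x y → (x + a) - (y + a) ≈ x - y
    difference x y = trans (+-congˡ (-‿anti-homo-+ y a))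
      (trans (+-assoc x a _) (+-congˡ (x+[-x+y]≈y a (- y))))

    convex-self : ∀ t → (1# - t) * a + t * a ≈ a
    convex-self t = trans (sym (distribʳ a (1# - t) t))
      (trans (*-congʳ (1-t+t≈1 t)) (*-identityˡ a))

-- Operations on realizations.

module Realizations (em : ExcludedMiddle 0ℓ) (ℝ : RealNumbers) where
  open RealNumbers ℝ hiding (zero)
  open Euclidean ℝ
  open OrderedField ℝ
  open Geometry ℝ
  open Realization

  trace : ∀ {n d} {C : Code n} (R : Realization ℝ C d) {p} → p ∈ X R →
          ∃[ σ ] σ ∈ C × Matches σ (λ i → U R i p)
  trace R {p} p∈X with Matches-total em (λ i → U R i p)
  ... | σ , m = σ , proj₂ (realizes R) (Matches⇒code p∈X m) , m

  realizer : ∀ {n d} {C : Code n} (R : Realization ℝ C d) {σ} → σ ∈ C →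
             ∃[ p ] p ∈ X R × Matches σ (λ i → U R i p)
  realizer R σ∈C = code⇒Matches (proj₁ (realizes R) σ∈C)

  -- A point has the codeword of its image, so no codeword is gained; `section` places a point over
  -- each realizing point, so none is lost.
  preimage : ∀ {n k l} {C : Code n} → AffineContraction k l → Realization ℝ C l → Realization ℝ C k
  preimage {C = C} f R = record
    { X        = map ⊢ X R
    ; U        = λ i → map ⊢ U R i
    ; X-open   = preimage-open (X R) (X-open R)
    ; X-convex = preimage-convex (X R) (X-open R) (X-convex R)
    ; U⊆X      = λ i → U⊆X R i
    ; U-open   = λ i → preimage-open (U R i) (U-open R i)
    ; U-convex = λ i → preimage-convex (U R i) (U-open R i) (U-convex R i)
    ; realizes = encode , decode
    }
    where
    open AffineContraction f
    encode : ∀ {σ} → σ ∈ C → σ ∈ code (λ i → map ⊢ U R i) (map ⊢ X R)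
    encode σ∈C with realizer R σ∈C
    ... | p , p∈X , m = Matches⇒code {p = section p}
      (IsOpen⇒resp (X-open R) (λ i → sym (map-section p i)) p∈X)
      (λ i → ⇔.trans (m i) (mk⇔
        (IsOpen⇒resp (U-open R i) (λ j → sym (map-section p j)))
        (IsOpen⇒resp (U-open R i) (map-section p))))
    decode : ∀ {σ} → σ ∈ code (λ i → map ⊢ U R i) (map ⊢ X R) → σ ∈ C
    decode σ∈code with code⇒Matches σ∈code
    ... | p , p∈X , m = proj₂ (realizes R) (Matches⇒code p∈X m)

  -- Points of `H` keep their codewords, so cutting down to `H` can only lose words, and the last
  -- hypothesis prevents that.
  restrict : ∀ {n d} {C : Code n} (R : Realization ℝ C d) (H : Pred (Space d) 0ℓ) →
             IsOpen H → IsConvexSet H →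
             (∀ {σ} → σ ∈ C → ∃[ p ] p ∈ X R × p ∈ H × Matches σ (λ i → U R i p)) →
             Realization ℝ C d
  restrict {C = C} R H H-open H-convex realizerInH = record
    { X        = X R ∩ H
    ; U        = λ i → U R i ∩ H
    ; X-open   = ∩-open (X-open R) H-open
    ; X-convex = ∩-convex (X R) H (X-convex R) H-convex
    ; U⊆X      = λ { i (p∈U , p∈H) → U⊆X R i p∈U , p∈H }
    ; U-open   = λ i → ∩-open (U-open R i) H-open
    ; U-convex = λ i → ∩-convex (U R i) H (U-convex R i) H-convex
    ; realizes = encode , decode
    }
    where
    ∩H : ∀ {p} → p ∈ H → ∀ i → U R i p ⇔ (U R i ∩ H) p
    ∩H p∈H i = mk⇔ (_, p∈H) proj₁

    encode : ∀ {σ} → σ ∈ C → σ ∈ code (λ i → U R i ∩ H) (X R ∩ H)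
    encode σ∈C with realizerInH σ∈C
    ... | p , p∈X , p∈H , m = Matches⇒code (p∈X , p∈H) (λ i → ⇔.trans (m i) (∩H p∈H i))
    decode : ∀ {σ} → σ ∈ code (λ i → U R i ∩ H) (X R ∩ H) → σ ∈ C
    decode σ∈code with code⇒Matches σ∈code
    ... | p , (p∈X , p∈H) , m =
      proj₂ (realizes R) (Matches⇒code p∈X (λ i → ⇔.trans (m i) (⇔.sym (∩H p∈H i))))

  -- Points of `U R j` have exactly the codewords of `E` that contain `j`. The two hypotheses say
  -- that these words, read along `e`, are precisely those of `C`, so `U R j` can serve as the
  -- ambient set.
  link : ∀ {k n d} {C : Code k} {E : Code n} (j : Fin n) (e : Fin k → Fin n) →
         (∀ {c} → c ∈ C → ∃[ σ ] σ ∈ E × j ∈ₛ σ × (∀ i → i ∈ₛ c ⇔ e i ∈ₛ σ)) →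
         (∀ {σ} → σ ∈ E → j ∈ₛ σ → ∃[ c ] c ∈ C × (∀ i → i ∈ₛ c ⇔ e i ∈ₛ σ)) →
         Realization ℝ E d → Realization ℝ C d
  link {C = C} j e extend contract R = record
    { X        = U R j
    ; U        = V
    ; X-open   = U-open R j
    ; X-convex = U-convex R j
    ; U⊆X      = λ i → proj₂
    ; U-open   = λ i → ∩-open (U-open R (e i)) (U-open R j)
    ; U-convex = λ i → ∩-convex (U R (e i)) (U R j) (U-convex R (e i)) (U-convex R j)
    ; realizes = encode , decode
    }
    where
    V : Fin _ → Pred (Space _) 0ℓ
    V i = U R (e i) ∩ U R j

    ∩j : ∀ {p} → p ∈ U R j → ∀ i → U R (e i) p ⇔ V i p
    ∩j p∈Uj i = mk⇔ (_, p∈Uj) proj₁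

    encode : ∀ {c} → c ∈ C → c ∈ code V (U R j)
    encode c∈C with extend c∈C
    ... | σ , σ∈E , j∈σ , c~σ with realizer R σ∈E
    ...   | p , _ , m = Matches⇒code (to (m j) j∈σ)
      (λ i → ⇔.trans (c~σ i) (⇔.trans (m (e i)) (∩j (to (m j) j∈σ) i)))
    decode : ∀ {c} → c ∈ code V (U R j) → c ∈ C
    decode c∈code with code⇒Matches c∈code
    -- The word of `p` in `E` contracts to some `c′` in `C`; both `c′` and the given word match the
    -- sets `V` at `p`, hence coincide.
    ... | p , p∈Uj , m with trace R (U⊆X R j p∈Uj)
    ...   | σ , σ∈E , mσ with contract σ∈E (from (mσ j) p∈Uj)
    ...     | c′ , c′∈C , c′~σ = ≡.subst C (Matches-unique m′ m) c′∈C
      where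
      m′ : Matches c′ (λ i → V i p)
      m′ i = ⇔.trans (c′~σ i) (⇔.trans (mσ (e i)) (∩j p∈Uj i))

  -- Raising the dimension and moving into a half-space.

  raise : ∀ {n k l} {C : Code n} → k ℕ.≤′ l → Realization ℝ C k → Realization ℝ C l
  raise ℕ.≤′-refl       R = R
  raise (ℕ.≤′-step k≤l) R = preimage (dropFirst _) (raise k≤l R)

  -- Finiteness of `Subset n` for upward closed conditions: subsets split by their first entry, and
  -- the larger of the two bounds serves both halves.
  commonBound : ∀ {n} (P : Subset n → Carrier → Set) → (∀ σ {a b} → a ≤ b → P σ a → P σ b) →
                (∀ σ → ∃ (P σ)) → ∃[ a ] ∀ σ → P σ a
  commonBound {ℕ.zero} P mono bound with bound []
  ... | a , p = a , λ { [] → p }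
  commonBound {ℕ.suc n} P mono bound
    with commonBound (P ∘ (inside ∷_)) (mono ∘ (inside ∷_)) (bound ∘ (inside ∷_))
       | commonBound (P ∘ (outside ∷_)) (mono ∘ (outside ∷_)) (bound ∘ (outside ∷_))
  ... | a , p | b , q with ≤-total a b
  ...   | inj₁ a≤b = b , λ { (true ∷ σ) → mono _ a≤b (p σ) ; (false ∷ σ) → q σ }
  ...   | inj₂ b≤a = a , λ { (true ∷ σ) → p σ ; (false ∷ σ) → mono _ b≤a (q σ) }

  -- There are finitely many codewords, so one translation moves a realizing
  -- point of each into the half-space.
  toPositive : ∀ {n d} {C : Code n} → Realization ℝ C (ℕ.suc d) →
               ∃[ R ] X {C = C} {d = ℕ.suc d} R ⊆ Positive
  toPositive {d = d} {C = C} R =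
    -- First cut down to the points with `x zero + a` positive; pulling back along the shift by
    -- `- a` then carries this half-space onto `Positive`.
    preimage (translation _ (- a)) (restrict R (map ⊢ Positive)
      (λ {x} → preimage-open Positive (λ {x} → Positive-open {x = x}) {x})
      (λ {x} {y} → preimage-convex Positive (λ {x} → Positive-open {x = x})
        (λ {x} {y} → Positive-convex {x = x} {y}) {x} {y})
      (realizerInH _))
    , λ { {x} (_ , 0<x₀-a+a) → <-respʳ-≈ (x-y+y≈x a (x zero)) 0<x₀-a+a }
    where
    -- With `σ ∈ C` as a premise the condition is vacuous off the code, so `commonBound` may range
    -- over all subsets.
    RealizedAbove : Subset _ → Carrier → Set
    RealizedAbove σ a = σ ∈ C → ∃[ p ] p ∈ X R × 0# < p zero + a × Matches σ (λ i → U R i p)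

    bound : ∀ σ → ∃ (RealizedAbove σ)
    bound σ with em {σ ∈ C}
    ... | no σ∉C = 0# , λ σ∈C → contradiction σ∈C σ∉C
    ... | yes σ∈C with realizer R σ∈C
    -- This shift moves coordinate zero of `p` to `1#`.
    ...   | p , p∈X , m = 1# - p zero , λ _ → p , p∈X ,
      <-respʳ-≈ (sym (trans (sym (+-assoc _ _ _)) (xyx⁻¹≈y (p zero) 1#))) 0<1 , m

    common : ∃[ a ] ∀ σ → RealizedAbove σ a
    common = commonBound RealizedAbove
      (λ { σ a≤b r σ∈C → let p , p∈X , 0<p+a , m = r σ∈C in
           p , p∈X , <-≤-trans 0<p+a (+-monoʳ-≤ (p zero) a≤b) , m })
      bound

    a = proj₁ common
    realizerInH = proj₂ common
    open AffineContraction (translation (ℕ.suc d) a)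

  -- Realizing the factors and the coproduct.

  module _ {n m : ℕ} {C : Code n} {D : Code m} where
    open Coproduct {n} {m}

    private
      E : Code (n ℕ.+ m ℕ.+ 2)
      E = (C ∐ D) ∪ ｛ ⊥ ｝

    -- Among the words of `E` only the left words contain `leftTag`: the right words and `⊥` lack
    -- it.
    leftFactor : ∀ {d} → Realization ℝ E d → Realization ℝ C d
    leftFactor = link leftTag leftIndex
      (λ {c} c∈C → leftWord c , inj₁ (left c∈C) , leftTag∈leftWord c , ∈-leftWord c)
      λ { (inj₁ (left {c} c∈C)) _ → c , c∈C , ∈-leftWord c
        ; (inj₁ (right {d} _)) h → contradiction h (leftTag∉rightWord d)
        ; (inj₂ ≡.refl) h → contradiction h ∉⊥ }

    rightFactor : ∀ {d} → Realization ℝ E d → Realization ℝ D d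
    rightFactor = link rightTag rightIndex
      (λ {d} d∈D → rightWord d , inj₁ (right d∈D) , rightTag∈rightWord d , ∈-rightWord d)
      λ { (inj₁ (right {d} d∈D)) _ → d , d∈D , ∈-rightWord d
        ; (inj₁ (left {c} _)) h → contradiction h (rightTag∉leftWord c)
        ; (inj₂ ≡.refl) h → contradiction h ∉⊥ }

    module _ {d : ℕ} (R : Realization ℝ C d) (S : Realization ℝ D d)
             (disjoint : ∀ {p} → p ∈ X R → ¬ p ∈ X S)
             (outsidePoint : ∃[ p ] ¬ p ∈ X R × ¬ p ∈ X S) where

      private
        -- The sets are given by cases on this sum, and the `index-` equations carry the cases over
        -- to positions in the concatenated word.
        Index : Set
        Index = (Fin n ⊎ Fin m) ⊎ Fin 2

        W : Index → Pred (Space d) 0ℓ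
        W (inj₁ (inj₁ i))       = U R i
        W (inj₁ (inj₂ j))       = U S j
        W (inj₂ zero)           = X R
        W (inj₂ (fsuc zero))     = X S

        W-open : ∀ s → IsOpen (W s)
        W-open (inj₁ (inj₁ i))   = U-open R i
        W-open (inj₁ (inj₂ j))   = U-open S j
        W-open (inj₂ zero)       = X-open R
        W-open (inj₂ (fsuc zero)) = X-open S

        W-convex : ∀ s → IsConvexSet (W s)
        W-convex (inj₁ (inj₁ i))   = U-convex R i
        W-convex (inj₁ (inj₂ j))   = U-convex S j
        W-convex (inj₂ zero)       = X-convex R
        W-convex (inj₂ (fsuc zero)) = X-convex S

        W⊆X : ∀ s {p} → p ∈ W s → p ∈ X R ⊎ p ∈ X S
        W⊆X (inj₁ (inj₁ i))   = inj₁ ∘ U⊆X R i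
        W⊆X (inj₁ (inj₂ j))   = inj₂ ∘ U⊆X S j
        W⊆X (inj₂ zero)       = inj₁
        W⊆X (inj₂ (fsuc zero)) = inj₂

        index : Fin (n ℕ.+ m ℕ.+ 2) → Index
        index = map₁ (splitAt n) ∘ splitAt (n ℕ.+ m)

        index-left : ∀ i → index (leftIndex i) ≡ inj₁ (inj₁ i)
        index-left i rewrite splitAt-↑ˡ (n ℕ.+ m) (i ↑ˡ m) 2 | splitAt-↑ˡ n i m = ≡.refl

        index-right : ∀ j → index (rightIndex j) ≡ inj₁ (inj₂ j)
        index-right j rewrite splitAt-↑ˡ (n ℕ.+ m) (n ↑ʳ j) 2 | splitAt-↑ʳ n m j = ≡.refl

        index-tag : ∀ k → index ((n ℕ.+ m) ↑ʳ k) ≡ inj₂ k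
        index-tag k rewrite splitAt-↑ʳ (n ℕ.+ m) 2 k = ≡.refl

        V : Fin (n ℕ.+ m ℕ.+ 2) → Pred (Space d) 0ℓ
        V = W ∘ index

        word-Matches : ∀ {p c d τ} → Matches c (λ i → U R i p) → Matches d (λ j → U S j p) →
                       Matches τ (λ k → W (inj₂ k) p) →
                       Matches ((c ++ d) ++ τ) (λ i → V i p)
        word-Matches {p} {c} {d} {τ} mc md mτ = ++-Matches {σ = c ++ d} (++-Matches {σ = c}
          (λ i → ≡.subst (λ s → _ ⇔ W s p) (≡.sym (index-left i)) (mc i))
          (λ j → ≡.subst (λ s → _ ⇔ W s p) (≡.sym (index-right j)) (md j)))
          (λ k → ≡.subst (λ s → _ ⇔ W s p) (≡.sym (index-tag k)) (mτ k))

        -- Disjointness puts `p` outside `X S` and hence outside every `U S j`, which accounts for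
        -- the block `⊥` and the missing right tag.
        leftWord-Matches : ∀ {p c} → p ∈ X R → Matches c (λ i → U R i p) →
                           Matches (leftWord c) (λ i → V i p)
        leftWord-Matches p∈R mc = word-Matches mc
          (⊥-Matches λ j → disjoint p∈R ∘ U⊆X S j)
          (∷-Matches (mk⇔ (λ _ → p∈R) (λ _ → ≡.refl))
            (∷-Matches (mk⇔ (λ ()) (⊥-elim ∘ disjoint p∈R)) λ ()))

        rightWord-Matches : ∀ {p d} → p ∈ X S → Matches d (λ j → U S j p) →
                            Matches (rightWord d) (λ i → V i p)
        rightWord-Matches p∈S md = word-Matches
          (⊥-Matches λ i p∈U → disjoint (U⊆X R i p∈U) p∈S) md
          (∷-Matches (mk⇔ (λ ()) (λ p∈R → ⊥-elim (disjoint p∈R p∈S)))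
            (∷-Matches (mk⇔ (λ _ → p∈S) (λ _ → ≡.refl)) λ ()))

        none-Matches : ∀ {p} → ¬ p ∈ X R → ¬ p ∈ X S → Matches ⊥ (λ i → V i p)
        none-Matches p∉R p∉S = ⊥-Matches λ i p∈V → [ p∉R , p∉S ]′ (W⊆X (index i) p∈V)

        encode : ∀ {σ} → σ ∈ E → σ ∈ code V Universal
        encode (inj₁ (left c∈C)) with realizer R c∈C
        ... | p , p∈R , mc = Matches⇒code _ (leftWord-Matches p∈R mc)
        encode (inj₁ (right d∈D)) with realizer S d∈D
        ... | p , p∈S , md = Matches⇒code _ (rightWord-Matches p∈S md)
        encode (inj₂ ≡.refl) = let p , p∉R , p∉S = outsidePoint in
          Matches⇒code {p = p} _ (none-Matches p∉R p∉S)

        decode : ∀ {σ} → σ ∈ code V Universal → σ ∈ E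
        decode σ∈code with code⇒Matches σ∈code
        -- A point lies in `X R`, in `X S` or in neither, and its word is accordingly a left word, a
        -- right word or `⊥`.
        ... | p , _ , mσ with em {p ∈ X R} | em {p ∈ X S}
        ...   | yes p∈R | _ = let c , c∈C , mc = trace R p∈R in
          ≡.subst E (Matches-unique (leftWord-Matches p∈R mc) mσ) (inj₁ (left c∈C))
        ...   | no _ | yes p∈S = let d , d∈D , md = trace S p∈S in
          ≡.subst E (Matches-unique (rightWord-Matches p∈S md) mσ) (inj₁ (right d∈D))
        ...   | no p∉R | no p∉S = inj₂ (Matches-unique (none-Matches p∉R p∉S) mσ)

      -- The former ambient sets become the sets of the two tags. Enlarging the ambient set to the
      -- whole space adds the word `⊥`, realized at `outsidePoint`, and no other.
      disjointCoproduct : Realization ℝ E d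
      disjointCoproduct = record
        { X        = Universal
        ; U        = V
        ; X-open   = Universal-open
        ; X-convex = _
        ; U⊆X      = _
        ; U-open   = λ i → W-open (index i)
        ; U-convex = λ i → W-convex (index i)
        ; realizes = encode , decode
        }

    coproduct : ∀ {d} → 1 ℕ.≤ d → Realization ℝ C d → Realization ℝ D d → Realization ℝ E d
    -- Matching on `1 ≤ d` makes `d` a successor, so that there is a coordinate zero.
    coproduct (ℕ.s≤s _) R S =
      let R⁺ , R⁺>0 = toPositive R
          S⁺ , S⁺>0 = toPositive S
      in disjointCoproduct R⁺ (preimage (reflection _) S⁺)
        -- A common point would have both `p zero` and `- p zero` positive; adding `p zero` to the
        -- latter gives `p zero < 0#`.
        (λ {p} p∈R p∈S → asym (R⁺>0 p∈R) (<-respˡ-≈ (+-identityʳ (p zero))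
          (<-respʳ-≈ (-‿inverseʳ (p zero)) (+-monoʳ-< (p zero) (S⁺>0 p∈S)))))
        -- The origin lies on the separating hyperplane, hence outside both open half-spaces.
        ((λ _ → 0#)
        , (λ 0∈R → irrefl refl (R⁺>0 0∈R))
        , (λ 0∈S → irrefl (sym (trans (sym (+-identityˡ _)) (-‿inverseʳ 0#))) (S⁺>0 0∈S)))

-- Admissible dimensions and the minimal one.

module _ (em : ExcludedMiddle (suc 0ℓ)) (ℝ : RealNumbers) where
  open Realizations (lowerExcludedMiddle em) ℝ

  raiseConvex : ∀ {n} {C : Code n} {k l} → k ℕ.≤ l → IsConvexIn ℝ C k → IsConvexIn ℝ C l
  raiseConvex k≤l (1≤k , R) = ℕ.≤-trans 1≤k k≤l , raise (ℕ.≤⇒≤′ k≤l) R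

  module _ {n m : ℕ} {C : Code n} {D : Code m} where

    ∐-convex : ∀ {k l} → IsConvexIn ℝ C k → IsConvexIn ℝ D l →
               IsConvexIn ℝ ((C ∐ D) ∪ ｛ ⊥ ｝) (k ⊔ l)
    ∐-convex {k} {l} c d with raiseConvex (ℕ.m≤m⊔n k l) c | raiseConvex (ℕ.m≤n⊔m k l) d
    ... | 1≤k⊔l , R | _ , S = 1≤k⊔l , coproduct 1≤k⊔l R S

    ∐-convexˡ : ∀ {d} → IsConvexIn ℝ ((C ∐ D) ∪ ｛ ⊥ ｝) d → IsConvexIn ℝ C d
    ∐-convexˡ (1≤d , R) = 1≤d , leftFactor {D = D} R

    ∐-convexʳ : ∀ {d} → IsConvexIn ℝ ((C ∐ D) ∪ ｛ ⊥ ｝) d → IsConvexIn ℝ D d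
    ∐-convexʳ (1≤d , R) = 1≤d , rightFactor {C = C} R

  mindim-IsLeast : ∀ {n} {C : Code n} (c : IsConvex ℝ C) →
                   IsLeast (IsConvexIn ℝ C) (mindim em ℝ C c)
  mindim-IsLeast c = proj₂ (least em _ c)

theorem4p4 : (em : ExcludedMiddle (suc 0ℓ)) (ℝ : RealNumbers)
    {n m : ℕ} (C : Code n) (D : Code m) → ⊥ ∈ C → ⊥ ∈ D →
    ((IsConvex ℝ C × IsConvex ℝ D) ⇔ IsConvex ℝ ((C ∐ D) ∪ ｛ ⊥ ｝)) ×
    ((c : IsConvex ℝ C) (d : IsConvex ℝ D) (e : IsConvex ℝ ((C ∐ D) ∪ ｛ ⊥ ｝)) →
    mindim em ℝ ((C ∐ D) ∪ ｛ ⊥ ｝) e ≡ mindim em ℝ C c ⊔ mindim em ℝ D d)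
theorem4p4 em ℝ C D _ _ =
    mk⇔ (λ { ((_ , c) , (_ , d)) → _ , ∐-convex em ℝ c d })
        (λ { (_ , e) → (_ , ∐-convexˡ em ℝ e) , (_ , ∐-convexʳ em ℝ {C = C} e) })
  , λ c d e →
      let cᵢ , c-least = mindim-IsLeast em ℝ c
          dᵢ , d-least = mindim-IsLeast em ℝ d
          eᵢ , e-least = mindim-IsLeast em ℝ e
      -- The maximum of the factors' minimal dimensions is admissible for the coproduct, and the
      -- minimal dimension of the coproduct is admissible for each factor.
      in ℕ.≤-antisym
        (e-least _ (∐-convex em ℝ cᵢ dᵢ))
        (ℕ.⊔-lub (c-least _ (∐-convexˡ em ℝ eᵢ)) (d-least _ (∐-convexʳ em ℝ {C = C} eᵢ)))
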